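{- Let $n\ge 1$ and let $\mathcal{I}$ be an interval hypergraph on $[n]$ containing all singletons $\{i\}$, $i\in[n]$. Then the hypergraphic poset $P_{\mathcal{I}}$ is a lattice if and only if $\mathcal{I}$ is closed under intersection, i.e. $I,J\in\mathcal{I}$ and $I\cap J\neq\varnothing$ imply $I\cap J\in\mathcal{I}$.
   Context: A hypergraph $\mathcal{H}$ on $[n]=\{1,\dots,n\}$ is a collection of subsets of $[n]$; by convention it contains all singletons. An interval hypergraph is a hypergraph all of whose members are intervals $[i,j]=\{i,i+1,\dots,j\}$. An orientation of $\mathcal{H}$ is a map $O:\mathcal{H}\to[n]$ with $O(H)\in H$ for all $H$. It is acyclic if there are no $H_1,\dots,H_k\in\mathcal{H}$, $k\ge2$, with $O(H_{i+1})\in H_i\setminus\{O(H_i)\}$ for $i\in[k-1]$ and $O(H_1)\in H_k\setminus\{O(H_k)\}$. Two orientations $O\neq O'$ are related by an increasing flip (from $O$ to $O'$) if there exist $1\le i<j\le n$ such that for all $H\in\mathcal{H}$: if $O(H)\ne O'(H)$ then $O(H)=i$ and $O'(H)=j$; and if $\{i,j\}\subseteq H$ then $O(H)=i\iff O'(H)=j$. The hypergraphic poset $P_{\mathcal{H}}$ is the transitive closure of the increasing flip relation on the set of acyclic orientations of $\mathcal{H}$ (equivalently, the transitive closure of the graph of the polytope $\sum_{H\in\mathcal{H}}\mathrm{conv}\{e_h:h\in H\}$ oriented in the direction $(n-1,n-3,\dots,1-n)$). -}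

module Defs where

open import Algebra.Core using (Op₂)
open import Data.Bool.Base using (Bool; T)
open import Data.Fin.Base using (Fin; zero; suc; inject₁; fromℕ; _≤_; _<_)
open import Data.Fin.Subset using (Subset; _∈_; _∩_; Nonempty)
open import Data.Nat.Base using (ℕ; _+_)
open import Data.Product.Base using (Σ; ∃₂; _×_; proj₁)
open import Function.Bundles using (_⇔_)
open import Level using (0ℓ)
open import Relation.Binary.Core using (Rel)
open import Relation.Binary.Construct.Closure.Transitive using (TransClosure)
import Relation.Binary.Construct.StrictToNonStrict as ToNonStrict
open import Relation.Binary.Lattice.Structures using (IsLattice)
open import Relation.Binary.PropositionalEquality.Core using (_≡_; _≢_)
open import Relation.Nullary.Negation.Core using (¬_)

-- The ground set {1,…,n} is Fin n.  A hypergraph is given by its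
-- characteristic function, so that membership of a subset is decidable
-- and has at most one proof.

Hypergraph : ℕ → Set
Hypergraph n = Subset n → Bool

infix 4 _∈ₕ_

_∈ₕ_ : ∀ {n} → Subset n → Hypergraph n → Set
H ∈ₕ ℋ = T (ℋ H)

Edge : ∀ {n} → Hypergraph n → Set
Edge {n} ℋ = Σ (Subset n) (_∈ₕ ℋ)

-- The condition i ≤ j makes intervals nonempty; an empty hyperedge would
-- leave no orientations.

IsInterval : ∀ {n} → Subset n → Set
IsInterval {n} H = ∃₂ λ (i j : Fin n) → i ≤ j × (∀ x → x ∈ H ⇔ (i ≤ x × x ≤ j))

IsIntervalHypergraph : ∀ {n} → Hypergraph n → Set
IsIntervalHypergraph ℋ = ∀ H → H ∈ₕ ℋ → IsInterval H

ClosedUnderIntersection : ∀ {n} → Hypergraph n → Set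
ClosedUnderIntersection ℋ =
  ∀ I J → I ∈ₕ ℋ → J ∈ₕ ℋ → Nonempty (I ∩ J) → (I ∩ J) ∈ₕ ℋ

module _ {n : ℕ} (ℋ : Hypergraph n) where

  IsOrientation : (Edge ℋ → Fin n) → Set
  IsOrientation O = ∀ H → O H ∈ proj₁ H

  -- A sequence H₁,…,H_k with k = 2 + m ≥ 2; members may repeat.

  IsCycle : (Edge ℋ → Fin n) → (m : ℕ) → (Fin (2 + m) → Edge ℋ) → Set
  IsCycle O m H =
      (∀ (i : Fin (1 + m)) → H (inject₁ i) ↝ H (suc i))
    × H (fromℕ (1 + m)) ↝ H zero
    where
    _↝_ : Rel (Edge ℋ) 0ℓ
    G ↝ G′ = O G′ ∈ proj₁ G × O G′ ≢ O G

  IsAcyclic : (Edge ℋ → Fin n) → Set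
  IsAcyclic O = ¬ (∃₂ λ m H → IsCycle O m H)

  record AcyclicOrientation : Set where
    field
      orient        : Edge ℋ → Fin n
      isOrientation : IsOrientation orient
      isAcyclic     : IsAcyclic orient

  open AcyclicOrientation

  infix 4 _≈ₒ_

  _≈ₒ_ : Rel AcyclicOrientation 0ℓ
  O ≈ₒ O′ = ∀ H → orient O H ≡ orient O′ H

  IncreasingFlip : Rel AcyclicOrientation 0ℓ
  IncreasingFlip O O′ =
    ¬ (O ≈ₒ O′) ×
    ∃₂ λ (i j : Fin n) → i < j × (∀ H →
        (orient O H ≢ orient O′ H → orient O H ≡ i × orient O′ H ≡ j)
      × (i ∈ proj₁ H → j ∈ proj₁ H → orient O H ≡ i ⇔ orient O′ H ≡ j))

  infix 4 _<ₒ_ _≤ₒ_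

  _<ₒ_ : Rel AcyclicOrientation 0ℓ
  _<ₒ_ = TransClosure IncreasingFlip

  -- O ≤ₒ O′ unfolds to  O <ₒ O′ ⊎ O ≈ₒ O′.

  _≤ₒ_ : Rel AcyclicOrientation 0ℓ
  _≤ₒ_ = ToNonStrict._≤_ _≈ₒ_ _<ₒ_

  HypergraphicPosetIsLattice : Set
  HypergraphicPosetIsLattice =
    ∃₂ λ (_∨_ _∧_ : Op₂ AcyclicOrientation) → IsLattice _≈ₒ_ _≤ₒ_ _∨_ _∧_

{-# OPTIONS --safe #-}

-- For intervals, acyclicity only has to be tested on pairs of hyperedges, and
-- A ≤ B in the hypergraphic poset iff A(H) ≤ B(H) for all H: if A lies
-- pointwise below B and A ≠ B, some increasing flip of A stays below B.
-- If ℐ is closed under intersection, acyclicity says that C(I) ∈ K ⊆ I implies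
-- C(I) = C(K), and the join of A and B sends I to
--   min { x ∈ I ∣ A(K) ≤ x and B(K) ≤ x for all K ⊆ I with x ∈ K };
-- the meet is dual.  Conversely, let I = [a,b] and J = [c,d] with a ≤ c < b ≤ d
-- and [c,b] ∉ ℐ.  There are A, B ≤ C, D such that any E between them has
-- E(I) = c and E(J) = b, which is not acyclic.

module Submission where

open import Defs
open import Data.Bool.Properties using (T?; T-irrelevant)
open import Data.Nat.Base as ℕ using (ℕ; zero; suc; _+_; _∸_; _≤_)
import Data.Nat.Properties as ℕ
open import Data.Nat.Induction using (<-wellFounded)
open import Data.Fin.Base as Fin using (Fin; zero; suc; toℕ; fromℕ; inject₁)
import Data.Fin.Properties as Fin
open import Data.Fin.Subset using (Subset; inside; outside; ⁅_⁆; _∈_; _⊆_; _∩_)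
open import Data.Fin.Subset.Properties
  using ( anySubset?; _∈?_; _⊆?_; ⊆-antisym; ∩-comm; p∩q⊆p; p∩q⊆q; x∈p∩q⁺; x∈p∩q⁻
        ; x∈⁅x⁆; x∈⁅y⁆⇒x≡y)
open import Data.List.Base using (filter; allFin)
import Data.List.Extrema as Extrema
open import Data.List.Membership.Propositional.Properties using (∈-filter⁺; ∈-allFin)
import Data.List.Relation.Unary.All as All
open import Data.List.Relation.Unary.All.Properties using (all-filter)
open import Data.Product.Base using (∃; ∃₂; _×_; _,_; proj₁; proj₂)
open import Data.Sum.Base using (_⊎_; inj₁; inj₂)
open import Data.Vec.Base using ([]; _∷_)
open import Function.Base using (_∘_; id; flip)
open import Function.Bundles using (_⇔_; mk⇔; Equivalence)
open import Induction.WellFounded using (Acc; acc)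
open import Level using (0ℓ)
open import Relation.Binary.Bundles using (TotalOrder)
open import Relation.Binary.Core using (Rel)
open import Relation.Binary.Definitions using (tri<; tri≈; tri>)
open import Relation.Binary.Construct.Closure.Transitive using (TransClosure; [_]; _∷_; _∷ʳ_)
import Relation.Binary.Construct.Flip.EqAndOrd as Flip
open import Relation.Binary.Lattice.Structures using (IsLattice)
open import Relation.Binary.PropositionalEquality
  using (_≡_; _≢_; refl; sym; trans; cong; subst; subst₂)
open import Relation.Binary.Structures using (IsDecTotalOrder; IsPartialOrder)
open import Relation.Nullary.Decidable
  using (Dec; yes; no; map′; ¬?; _×-dec_; _→-dec_; decidable-stable)
open import Relation.Nullary.Negation using (¬_; contradiction)
open import Relation.Unary using (Pred; Decidable)

open AcyclicOrientation

private
  variable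
    n : ℕ

-- Sums over subsets, extremal elements and search over hyperedges.

sumSubsets : (Subset n → ℕ) → ℕ
sumSubsets {zero}  f = f []
sumSubsets {suc n} f = sumSubsets (f ∘ (inside ∷_)) + sumSubsets (f ∘ (outside ∷_))

sumSubsets-mono-≤ : {f g : Subset n → ℕ} → (∀ H → f H ≤ g H) → sumSubsets f ≤ sumSubsets g
sumSubsets-mono-≤ {zero}  f≤g = f≤g []
sumSubsets-mono-≤ {suc n} f≤g =
  ℕ.+-mono-≤ (sumSubsets-mono-≤ (f≤g ∘ (inside ∷_))) (sumSubsets-mono-≤ (f≤g ∘ (outside ∷_)))

sumSubsets-mono-< : {f g : Subset n → ℕ} → (∀ H → f H ≤ g H) →
                    ∀ H → f H ℕ.< g H → sumSubsets f ℕ.< sumSubsets g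
sumSubsets-mono-< f≤g []            f<g = f<g
sumSubsets-mono-< f≤g (inside ∷ H)  f<g =
  ℕ.+-mono-<-≤ (sumSubsets-mono-< (f≤g ∘ (inside ∷_)) H f<g) (sumSubsets-mono-≤ (f≤g ∘ (outside ∷_)))
sumSubsets-mono-< f≤g (outside ∷ H) f<g =
  ℕ.+-mono-≤-< (sumSubsets-mono-≤ (f≤g ∘ (inside ∷_))) (sumSubsets-mono-< (f≤g ∘ (outside ∷_)) H f<g)

-- The order is a parameter: with `≥` the result is a greatest element, as in `flipTowards` and in
-- the construction of meets.
least : {_≼_ : Rel (Fin n) 0ℓ} → IsDecTotalOrder _≡_ _≼_ → {P : Pred (Fin n) 0ℓ} →
        Decidable P → ∃ P → ∃ λ m → P m × (∀ x → P x → m ≼ x)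
least {n} isDTO {P} P? (w , Pw) =
  min w candidates ,
  argmin-all id {P = P} Pw (all-filter P? (allFin n)) ,
  λ x Px → All.lookup (min≤xs w candidates) (∈-filter⁺ P? (∈-allFin x) Px)
  where
  totalOrder : TotalOrder 0ℓ 0ℓ 0ℓ
  totalOrder = record { isTotalOrder = IsDecTotalOrder.isTotalOrder isDTO }
  open Extrema totalOrder
  candidates = filter P? (allFin n)

Fin-≥-isDecTotalOrder : IsDecTotalOrder {A = Fin n} _≡_ (flip Fin._≤_)
Fin-≥-isDecTotalOrder = Flip.isDecTotalOrder Fin.≤-isDecTotalOrder

module _ (ℋ : Hypergraph n) where

  -- Membership in `ℋ` has at most one proof, so testing `P` at one proof settles it for the whole
  -- subset.
  anyEdge? : {P : Pred (Edge ℋ) 0ℓ} → Decidable P → Dec (∃ P)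
  anyEdge? {P} P? =
    map′ (λ (H , h , p) → (H , h) , p) (λ ((H , h) , p) → H , h , p) (anySubset? onSubset?)
    where
    onSubset? : ∀ H → Dec (∃ λ h → P (H , h))
    onSubset? H with T? (ℋ H)
    ... | no ¬h = no (¬h ∘ proj₁)
    ... | yes h =
      map′ (h ,_) (λ (h′ , p) → subst (λ h → P (H , h)) (T-irrelevant h′ h) p) (P? (H , h))

  allEdges? : {P : Pred (Edge ℋ) 0ℓ} → Decidable P → Dec (∀ H → P H)
  allEdges? P? =
    map′ (λ ¬e H → decidable-stable (P? H) (λ ¬p → ¬e (H , ¬p)))
         (λ all (H , ¬p) → ¬p (all H))
         (¬? (anyEdge? (¬? ∘ P?)))

  -- The case k = 2 of acyclicity, in positive form.
  PairwiseAcyclic : (Edge ℋ → Fin n) → Set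
  PairwiseAcyclic O = ∀ G H → O G ∈ proj₁ H → O H ∈ proj₁ G → O G ≡ O H

  acyclic⇒pairwiseAcyclic : ∀ {O} → IsAcyclic ℋ O → PairwiseAcyclic O
  acyclic⇒pairwiseAcyclic {O} acyclic G H OG∈H OH∈G = decidable-stable (O G Fin.≟ O H) λ OG≢OH →
    acyclic (0 , (λ { zero → G ; (suc zero) → H }) ,
             (λ { zero → OH∈G , OG≢OH ∘ sym }) , OG∈H , OG≢OH)

-- Intervals with respect to an arbitrary total order.

IntervalFor : Rel (Fin n) 0ℓ → Pred (Subset n) 0ℓ
IntervalFor _≼_ H = ∃₂ λ l r → l ≼ r × (∀ x → x ∈ H ⇔ (l ≼ x × x ≼ r))

flip-interval : {_≼_ : Rel (Fin n) 0ℓ} {H : Subset n} → IntervalFor _≼_ H → IntervalFor (flip _≼_) H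
flip-interval (l , r , l≼r , H⇔) =
  r , l , l≼r ,
  λ x → mk⇔ (λ x∈H → let (l≼x , x≼r) = Equivalence.to (H⇔ x) x∈H in x≼r , l≼x)
            (λ (x≼r , l≼x) → Equivalence.from (H⇔ x) (l≼x , x≼r))

-- Instantiated both with ≤ and with ≥ on Fin n.
module Intervals
  {_≼_ : Rel (Fin n) 0ℓ} (isDTO : IsDecTotalOrder _≡_ _≼_)
  (ℋ : Hypergraph n) (interval : (H : Edge ℋ) → IntervalFor _≼_ (proj₁ H)) where

  open IsDecTotalOrder isDTO using (total; antisym)
    renaming (refl to ≼-refl; trans to ≼-trans; _≤?_ to _≼?_)

  left right : Edge ℋ → Fin n
  left  H = proj₁ (interval H)
  right H = proj₁ (proj₂ (interval H))

  left≼ : ∀ H {x} → x ∈ proj₁ H → left H ≼ x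
  left≼ H x∈H = proj₁ (Equivalence.to (proj₂ (proj₂ (proj₂ (interval H))) _) x∈H)

  ≼right : ∀ H {x} → x ∈ proj₁ H → x ≼ right H
  ≼right H x∈H = proj₂ (Equivalence.to (proj₂ (proj₂ (proj₂ (interval H))) _) x∈H)

  between∈ : ∀ H x → left H ≼ x → x ≼ right H → x ∈ proj₁ H
  between∈ H x l≼x x≼r = Equivalence.from (proj₂ (proj₂ (proj₂ (interval H))) x) (l≼x , x≼r)

  left∈ : ∀ H → left H ∈ proj₁ H
  left∈ H = between∈ H _ ≼-refl (proj₁ (proj₂ (proj₂ (interval H))))

  right∈ : ∀ H → right H ∈ proj₁ H
  right∈ H = between∈ H _ (proj₁ (proj₂ (proj₂ (interval H)))) ≼-refl

  convex : ∀ H {x y z} → x ∈ proj₁ H → z ∈ proj₁ H → x ≼ y → y ≼ z → y ∈ proj₁ H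
  convex H x∈H z∈H x≼y y≼z =
    between∈ H _ (≼-trans (left≼ H x∈H) x≼y) (≼-trans y≼z (≼right H z∈H))

  -- The join in the intersection-closed case.

  module Join (closed : ClosedUnderIntersection ℋ) (A B : AcyclicOrientation ℋ) where

    Dominates : Edge ℋ → Fin n → Set
    Dominates I x = ∀ K → proj₁ K ⊆ proj₁ I → x ∈ proj₁ K → orient A K ≼ x × orient B K ≼ x

    Candidate : Edge ℋ → Fin n → Set
    Candidate I x = x ∈ proj₁ I × Dominates I x

    private
      leastCandidate : ∀ I → ∃ λ m → Candidate I m × (∀ x → Candidate I x → m ≼ x)
      -- The last element of `I` bounds all values of `A` and `B` on edges inside `I`, so a
      -- candidate exists.
      leastCandidate I = least isDTO candidate? (right I , right∈ I , λ K K⊆I _ →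
          ≼right I (K⊆I (isOrientation A K)) , ≼right I (K⊆I (isOrientation B K)))
        where
        candidate? : Decidable (Candidate I)
        candidate? x = x ∈? proj₁ I ×-dec allEdges? ℋ λ K →
          proj₁ K ⊆? proj₁ I →-dec (x ∈? proj₁ K →-dec
            (orient A K ≼? x ×-dec orient B K ≼? x))

    join : Edge ℋ → Fin n
    join I = proj₁ (leastCandidate I)

    join∈ : IsOrientation ℋ join
    join∈ I = proj₁ (proj₁ (proj₂ (leastCandidate I)))

    join-dominates : ∀ I → Dominates I (join I)
    join-dominates I = proj₂ (proj₁ (proj₂ (leastCandidate I)))

    join-least : ∀ I x → Candidate I x → join I ≼ x
    join-least I = proj₂ (proj₂ (leastCandidate I))

    A≼join : ∀ I → orient A I ≼ join I
    A≼join I = proj₁ (join-dominates I I id (join∈ I))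

    B≼join : ∀ I → orient B I ≼ join I
    B≼join I = proj₂ (join-dominates I I id (join∈ I))

    -- `D I` is itself a candidate: if `K ⊆ I` contains it, acyclicity gives `D K = D I`, and `D K`
    -- bounds `A K` and `B K`.
    join≼ : ∀ D → (∀ I → orient A I ≼ orient D I) → (∀ I → orient B I ≼ orient D I) →
            ∀ I → join I ≼ orient D I
    join≼ D A≼D B≼D I = join-least I _ (isOrientation D I , λ K K⊆I DI∈K →
      let DK≡DI = acyclic⇒pairwiseAcyclic ℋ (isAcyclic D) K I (K⊆I (isOrientation D K)) DI∈K
      in subst (orient A K ≼_) DK≡DI (A≼D K) , subst (orient B K ≼_) DK≡DI (B≼D K))

    -- If y ≺ C L, then C L lies outside K, else it would be the value of C at
    -- the edge K ∩ L; so L reaches over x, which already dominates C L, and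
    -- convexity of K gives a contradiction.
    private
      dominated : (C : AcyclicOrientation ℋ) → ∀ K L x y → y ≼ x →
                  x ∈ proj₁ K → y ∈ proj₁ K → y ∈ proj₁ L →
                  (∀ M → proj₁ M ⊆ proj₁ K → y ∈ proj₁ M → orient C M ≼ y) →
                  (x ∈ proj₁ L → orient C L ≼ x) → orient C L ≼ y
      dominated C K L x y y≼x x∈K y∈K y∈L dom-y dom-x
        with orient C L ∈? proj₁ K | total (orient C L) y
      ... | _         | inj₁ CL≼y = CL≼y
      ... | yes CL∈K  | inj₂ y≼CL = subst (_≼ y) CM≡CL (dom-y M (p∩q⊆p _ _) y∈M)
        where
        y∈M : y ∈ proj₁ K ∩ proj₁ L
        y∈M = x∈p∩q⁺ (y∈K , y∈L)
        M : Edge ℋ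
        M = proj₁ K ∩ proj₁ L , closed _ _ (proj₂ K) (proj₂ L) (y , y∈M)
        CM≡CL : orient C M ≡ orient C L
        CM≡CL = acyclic⇒pairwiseAcyclic ℋ (isAcyclic C) M L
          (p∩q⊆q _ _ (isOrientation C M)) (x∈p∩q⁺ (CL∈K , isOrientation C L))
      ... | no CL∉K   | inj₂ y≼CL = contradiction (convex K y∈K x∈K y≼CL CL≼x) CL∉K
        where
        CL≼x : orient C L ≼ x
        CL≼x with total (orient C L) x
        ... | inj₁ CL≼x = CL≼x
        ... | inj₂ x≼CL = dom-x (convex L y∈L (isOrientation C L) y≼x x≼CL)

    -- Edges inside `K` lie inside `I`, so `join I` is a candidate for `K`. Conversely, `dominated`
    -- makes `join K` a candidate for `I`.
    join-restrict : ∀ I K → proj₁ K ⊆ proj₁ I → join I ∈ proj₁ K → join I ≡ join K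
    join-restrict I K K⊆I x∈K = antisym x≼y y≼x
      where
      x y : Fin n
      x = join I
      y = join K
      y≼x : y ≼ x
      y≼x = join-least K x (x∈K , λ L L⊆K → join-dominates I L (K⊆I ∘ L⊆K))
      x≼y : x ≼ y
      x≼y = join-least I y (K⊆I (join∈ K) , λ L L⊆I y∈L →
        dominated A K L x y y≼x x∈K (join∈ K) y∈L
          (λ M M⊆K → proj₁ ∘ join-dominates K M M⊆K) (proj₁ ∘ join-dominates I L L⊆I) ,
        dominated B K L x y y≼x x∈K (join∈ K) y∈L
          (λ M M⊆K → proj₂ ∘ join-dominates K M M⊆K) (proj₂ ∘ join-dominates I L L⊆I))

    -- Both values lie in `I ∩ J`, an edge by closure, so both equal the value of `join` there.
    join-pairwiseAcyclic : PairwiseAcyclic ℋ join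
    join-pairwiseAcyclic I J CI∈J CJ∈I = trans
      (join-restrict I K (p∩q⊆p _ _) CI∈K)
      (sym (join-restrict J K (p∩q⊆q _ _) (x∈p∩q⁺ (CJ∈I , join∈ J))))
      where
      CI∈K : join I ∈ proj₁ I ∩ proj₁ J
      CI∈K = x∈p∩q⁺ (join∈ I , CI∈J)
      K : Edge ℋ
      K = proj₁ I ∩ proj₁ J , closed _ _ (proj₂ I) (proj₂ J) (_ , CI∈K)

  -- For s ≼ p, selects the first element of each edge in the order obtained from ≼
  -- by moving p to just before s.
  module Jump (s p : Fin n) where

    jump : Edge ℋ → Fin n
    jump H with p ∈? proj₁ H ×-dec s ≼? left H
    ... | yes _ = p
    ... | no  _ = left H

    Jumps : Pred (Edge ℋ) 0ℓ
    Jumps H = p ∈ proj₁ H × s ≼ left H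

    jump-p : ∀ H → Jumps H → jump H ≡ p
    jump-p H jumps with p ∈? proj₁ H ×-dec s ≼? left H
    ... | yes _ = refl
    ... | no ¬jumps = contradiction jumps ¬jumps

    jump-cases : ∀ H → jump H ≡ left H ⊎ jump H ≡ p × Jumps H
    jump-cases H with p ∈? proj₁ H ×-dec s ≼? left H
    ... | yes jumps = inj₂ (refl , jumps)
    ... | no _      = inj₁ refl

    jump∈ : IsOrientation ℋ jump
    jump∈ H with jump-cases H
    ... | inj₁ ≡left          = subst (_∈ proj₁ H) (sym ≡left) (left∈ H)
    ... | inj₂ (≡p , p∈H , _) = subst (_∈ proj₁ H) (sym ≡p) p∈H

    private
      -- As `left H` lies in `G`, it comes no earlier than `left G`, hence no earlier than `s`.
      -- Since `p` lies in `H`, the edge `H` jumps too.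
      jumps-together : ∀ G H → jump G ≡ p × Jumps G → jump G ∈ proj₁ H → jump H ∈ proj₁ G →
                       jump H ≡ left H → jump G ≡ jump H
      jumps-together G H (≡p , _ , s≼) OG∈H OH∈G OH≡left = trans ≡p (sym (jump-p H
        (subst (_∈ proj₁ H) ≡p OG∈H ,
         ≼-trans s≼ (subst (left G ≼_) OH≡left (left≼ G OH∈G)))))

    jump-pairwiseAcyclic : PairwiseAcyclic ℋ jump
    jump-pairwiseAcyclic G H OG∈H OH∈G with jump-cases G | jump-cases H
    ... | inj₂ (OG≡p , _) | inj₂ (OH≡p , _) = trans OG≡p (sym OH≡p)
    ... | inj₂ jumpsG     | inj₁ OH≡left    = jumps-together G H jumpsG OG∈H OH∈G OH≡left
    ... | inj₁ OG≡left    | inj₂ jumpsH     = sym (jumps-together H G jumpsH OH∈G OG∈H OG≡left)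
    ... | inj₁ OG≡left    | inj₁ OH≡left    = antisym
      (subst (_≼ jump H) (sym OG≡left) (left≼ G OH∈G))
      (subst (_≼ jump G) (sym OH≡left) (left≼ H OG∈H))

-- Acyclicity from pairs of hyperedges.

path : {A : Set} {R : Rel A 0ℓ} → ∀ m (f : Fin (2 + m) → A) →
       (∀ i → R (f (inject₁ i)) (f (suc i))) → TransClosure R (f zero) (f (fromℕ (suc m)))
path zero    f steps = [ steps zero ]
path (suc m) f steps = steps zero ∷ path m (f ∘ suc) (steps ∘ suc)

module IntervalHypergraph {n : ℕ} (ℋ : Hypergraph n) (isInterval : IsIntervalHypergraph ℋ) where

  interval : (H : Edge ℋ) → IntervalFor Fin._≤_ (proj₁ H)
  interval (H , h) = isInterval H h

  module Up   = Intervals Fin.≤-isDecTotalOrder ℋ interval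
  module Down = Intervals Fin-≥-isDecTotalOrder ℋ (flip-interval ∘ interval)

  open Up using (convex)

  module _ {O : Edge ℋ → Fin n} (O∈ : IsOrientation ℋ O) (pairwise : PairwiseAcyclic ℋ O) where

    -- There is no closed walk of ⇝: by convexity a walk a ⇝ m ⇝ b through its
    -- largest point m can be shortcut to a ⇝ b.
    private
      infix 4 _⇝_

      _⇝_ : Rel (Fin n) 0ℓ
      x ⇝ y = ∃ λ G → O G ≡ x × y ∈ proj₁ G × y ≢ x

      Below : ℕ → Rel (Fin n) 0ℓ
      Below k x y = x ⇝ y × toℕ x ℕ.< k × toℕ y ℕ.< k

      -- If `b ≤ a`, then `a` lies in `H` between `b` and `m`, and `G` and `H` form a two-cycle.
      -- Otherwise `b` lies in `G` between `a` and `m`.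
      shortcut : ∀ {a m b} → a ⇝ m → m ⇝ b → a Fin.< m → b Fin.< m → a ⇝ b
      shortcut {a} {m} {b} (G , refl , m∈G , _) (H , refl , b∈H , _) a<m b<m
        with toℕ b ℕ.≤? toℕ a
      ... | yes b≤a = contradiction
        (pairwise G H (convex H b∈H (O∈ H) b≤a (ℕ.<⇒≤ a<m)) m∈G) (Fin.<⇒≢ a<m)
      ... | no  b≰a =
        G , refl , convex G (O∈ G) m∈G (ℕ.<⇒≤ (ℕ.≰⇒> b≰a)) (ℕ.<⇒≤ b<m) ,
        b≰a ∘ ℕ.≤-reflexive ∘ cong toℕ

      below-top : ∀ {k} {z b : Fin n} →
                  toℕ z ℕ.< suc k → ¬ toℕ z ℕ.< k → b ≢ z → toℕ b ℕ.< suc k →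
                  toℕ b ℕ.< k × b Fin.< z
      below-top {k} {z} z≤k z≮k b≢z b≤k with ℕ.≤-antisym (ℕ.s≤s⁻¹ z≤k) (ℕ.≮⇒≥ z≮k)
      ... | refl = b<z , b<z
        where b<z = ℕ.≤∧≢⇒< (ℕ.s≤s⁻¹ b≤k) (b≢z ∘ Fin.toℕ-injective)

      -- Every step changes the point, so both neighbours of a visit to the point `k` are smaller
      -- and `shortcut` removes the visit.
      avoidTop : ∀ {k x y} → TransClosure (Below (suc k)) x y →
                 toℕ x ℕ.< k → toℕ y ℕ.< k → TransClosure (Below k) x y
      avoidTop [ s , _ ] x<k y<k = [ s , x<k , y<k ]
      avoidTop {k} (_∷_ {y = z} (s , _ , z≤k) w) x<k y<k with toℕ z ℕ.<? k
      ... | yes z<k = (s , x<k , z<k) ∷ avoidTop w z<k y<k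
      avoidTop ((s@(_ , _ , _ , z≢x) , x≤k , z≤k) ∷ [ t@(_ , _ , _ , y≢z) , _ , y≤k ])
               x<k y<k | no z≮k
        with below-top z≤k z≮k (z≢x ∘ sym) x≤k | below-top z≤k z≮k y≢z y≤k
      ... | _ , x<z | _ , y<z = [ shortcut s t x<z y<z , x<k , y<k ]
      avoidTop ((s@(_ , _ , _ , z≢x) , x≤k , z≤k) ∷ (t@(_ , _ , _ , b≢z) , _ , b≤k) ∷ w)
               x<k y<k | no z≮k
        with below-top z≤k z≮k (z≢x ∘ sym) x≤k | below-top z≤k z≮k b≢z b≤k
      ... | _ , x<z | b<k , b<z = (shortcut s t x<z b<z , x<k , b<k) ∷ avoidTop w b<k y<k

      noClosedWalk : ∀ k {x} → ¬ TransClosure (Below k) x x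
      noClosedWalk zero [ _ , () , _ ]
      noClosedWalk zero ((_ , () , _) ∷ _)
      noClosedWalk (suc k) {x} w with toℕ x ℕ.<? k
      ... | yes x<k = noClosedWalk k (avoidTop w x<k x<k)
      noClosedWalk (suc k) [ (_ , _ , _ , x≢x) , _ ] | no x≮k = x≢x refl
      -- The walk starts at the top point; rotating it by one step makes it start at `b`, below the
      -- top.
      noClosedWalk (suc k) (s@((_ , _ , _ , b≢x) , x≤k , b≤k) ∷ w) | no x≮k =
        noClosedWalk k (avoidTop (w ∷ʳ s) b<k b<k)
        where b<k = proj₁ (below-top x≤k x≮k b≢x b≤k)

    pairwiseAcyclic⇒acyclic : IsAcyclic ℋ O
    pairwiseAcyclic⇒acyclic (m , H , steps , close) =
      -- The values of `O` along the cycle form the closed walk, and `n` bounds every point.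
      noClosedWalk n (walk ∷ʳ edge close)
      where
      edge : ∀ {G G′} → O G′ ∈ proj₁ G × O G′ ≢ O G → Below n (O G) (O G′)
      edge (∈G , ≢) = (_ , refl , ∈G , ≢) , Fin.toℕ<n _ , Fin.toℕ<n _
      walk : TransClosure (Below n) (O (H zero)) (O (H (fromℕ (suc m))))
      walk = path m (O ∘ H) (edge ∘ steps)

  acyclicOrientation : ∀ {O} → IsOrientation ℋ O → PairwiseAcyclic ℋ O → AcyclicOrientation ℋ
  acyclicOrientation O∈ pairwise = record
    { isOrientation = O∈ ; isAcyclic = pairwiseAcyclic⇒acyclic O∈ pairwise }

  pairwise : (A : AcyclicOrientation ℋ) → PairwiseAcyclic ℋ (orient A)
  pairwise A = acyclic⇒pairwiseAcyclic ℋ (isAcyclic A)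

  -- Agreement of the pointwise order with the flip order.

  infix 4 _⊑_

  _⊑_ : Rel (AcyclicOrientation ℋ) 0ℓ
  A ⊑ B = ∀ H → orient A H Fin.≤ orient B H

  flip⇒⊑ : ∀ {A B} → IncreasingFlip ℋ A B → A ⊑ B
  flip⇒⊑ {A} {B} (_ , i , j , i<j , flips) H with orient A H Fin.≟ orient B H
  ... | yes A≡B = ℕ.≤-reflexive (cong toℕ A≡B)
  ... | no  A≢B with proj₁ (flips H) A≢B
  ...   | refl , refl = ℕ.<⇒≤ i<j

  <ₒ⇒⊑ : ∀ {A B} → _<ₒ_ ℋ A B → A ⊑ B
  <ₒ⇒⊑ {A} {B} [ s ] = flip⇒⊑ {A} {B} s
  <ₒ⇒⊑ {A} {B} (_∷_ {y = C} s w) H = ℕ.≤-trans (flip⇒⊑ {A} {C} s H) (<ₒ⇒⊑ w H)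

  ≤ₒ⇒⊑ : ∀ {A B} → _≤ₒ_ ℋ A B → A ⊑ B
  ≤ₒ⇒⊑ (inj₁ A<B) = <ₒ⇒⊑ A<B
  ≤ₒ⇒⊑ (inj₂ A≈B) H = ℕ.≤-reflexive (cong toℕ (A≈B H))

  -- The flip is from i to j, where i is the largest value of A on {H ∣ A H ≠ B H}
  -- and j > i is the largest value of B on {H ∣ A H = i} for which the flip does
  -- not overshoot B.
  module FlipTowards {A B : AcyclicOrientation ℋ} (A⊑B : A ⊑ B) where

    Raised : Pred (Fin n) 0ℓ
    Raised i = ∃ λ H → orient A H ≡ i × orient A H Fin.< orient B H

    raised? : Decidable Raised
    raised? i = anyEdge? ℋ λ H → orient A H Fin.≟ i ×-dec orient A H Fin.<? orient B H

    module At (i : Fin n) (i-max : ∀ k → Raised k → k Fin.≤ i) where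

      Target : Pred (Fin n) 0ℓ
      Target j = (∃ λ H → orient A H ≡ i × orient B H ≡ j × i Fin.< j) ×
                 (∀ H → orient A H ≡ i → j ∈ proj₁ H → j Fin.≤ orient B H)

      target? : Decidable Target
      target? j =
        (anyEdge? ℋ λ H → orient A H Fin.≟ i ×-dec (orient B H Fin.≟ j ×-dec i Fin.<? j)) ×-dec
        (allEdges? ℋ λ H → orient A H Fin.≟ i →-dec (j ∈? proj₁ H →-dec j Fin.≤? orient B H))

      -- The witness minimises B over {G ∣ A G = i and Q G}.
      target : {Q : Pred (Edge ℋ) 0ℓ} → Decidable Q →
               (∀ H → orient A H ≡ i → Q H → i Fin.< orient B H) →
               (∀ G H → orient A G ≡ i → Q G → orient A H ≡ i → orient B G ∈ proj₁ H → Q H) →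
               ∀ H → orient A H ≡ i → Q H →
               ∃ λ G → orient A G ≡ i × Q G × Target (orient B G)
      target {Q} Q? Q-above Q-upward H AH≡i QH
        with least Fin.≤-isDecTotalOrder
               (λ j → anyEdge? ℋ λ G → orient A G Fin.≟ i ×-dec (Q? G ×-dec orient B G Fin.≟ j))
               (orient B H , H , AH≡i , QH , refl)
      ... | _ , (G , AG≡i , QG , refl) , minimal =
        G , AG≡i , QG , (G , AG≡i , refl , Q-above G AG≡i QG) ,
        -- An edge `K` with value `i` that contains `B G` inherits `Q`, so minimality bounds `B G`
        -- by `B K`.
        λ K AK≡i ∈K → minimal _ (K , AK≡i , Q-upward G K AG≡i QG AK≡i ∈K , refl)

      i∈ : ∀ H → orient A H ≡ i → i ∈ proj₁ H
      i∈ H refl = isOrientation A H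

      -- Here `Q H` is `i < B H`. If `H` contains `B G` but `B H = i`, then `B H` lies in `G`, and
      -- acyclicity of `B` forces `B G = i`.
      initialTarget : Raised i → ∃ Target
      initialTarget (H , AH≡i , A<B)
        with target (λ H → i Fin.<? orient B H) (λ _ _ i<B → i<B)
               (λ G H AG≡i i<BG AH≡i BG∈H → ℕ.≤∧≢⇒< (subst (Fin._≤ orient B H) AH≡i (A⊑B H))
                 λ i≡BH → Fin.<⇒≢ i<BG (trans (Fin.toℕ-injective i≡BH)
                   (pairwise B H G (subst (_∈ proj₁ G) (Fin.toℕ-injective i≡BH) (i∈ G AG≡i)) BG∈H)))
               H AH≡i (subst (Fin._< orient B H) AH≡i A<B)
      ... | G , _ , _ , t = _ , t

      module FlipTo (j : Fin n) (target-j : Target j) (j-max : ∀ k → Target k → k Fin.≤ j) where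

        private
          H₀ : Edge ℋ
          H₀ = proj₁ (proj₁ target-j)
          AH₀≡i : orient A H₀ ≡ i
          AH₀≡i = proj₁ (proj₂ (proj₁ target-j))
          BH₀≡j : orient B H₀ ≡ j
          BH₀≡j = proj₁ (proj₂ (proj₂ (proj₁ target-j)))
          j∈H₀ : j ∈ proj₁ H₀
          j∈H₀ = subst (_∈ proj₁ H₀) BH₀≡j (isOrientation B H₀)

        i<j : i Fin.< j
        i<j = proj₂ (proj₂ (proj₂ (proj₁ target-j)))

        Affected : Pred (Edge ℋ) 0ℓ
        Affected H = orient A H ≡ i × j ∈ proj₁ H

        affected? : Decidable Affected
        affected? H = orient A H Fin.≟ i ×-dec j ∈? proj₁ H

        flipped : Edge ℋ → Fin n
        flipped H with affected? H
        ... | yes _ = j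
        ... | no  _ = orient A H

        flipped∈ : IsOrientation ℋ flipped
        flipped∈ H with affected? H
        ... | yes (_ , j∈H) = j∈H
        ... | no  _         = isOrientation A H

        module _ (H K : Edge ℋ) (AH≡i : orient A H ≡ i) (j∈H : j ∈ proj₁ H) (j∈K : j ∈ proj₁ K)
                 (AK∈H : orient A K ∈ proj₁ H) (AK≢i : orient A K ≢ i) where

          private
            k : Fin n
            k = orient A K
            k∈K : k ∈ proj₁ K
            k∈K = isOrientation A K

            -- Otherwise `i` lies in `K` between `k` and `j`, and acyclicity of `A` gives `k = i`.
            i<k : i Fin.< k
            i<k = ℕ.≰⇒> λ k≤i → AK≢i (trans
              (sym (pairwise A H K
                (subst (_∈ proj₁ K) (sym AH≡i) (convex K k∈K j∈K k≤i (ℕ.<⇒≤ i<j))) AK∈H))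
              AH≡i)

            -- `k` exceeds `i`, the largest value raised by `B`.
            BK≡k : orient B K ≡ k
            BK≡k = sym (Fin.toℕ-injective (ℕ.≤-antisym (A⊑B K)
              (ℕ.≮⇒≥ λ k<BK → ℕ.<⇒≱ i<k (i-max k (K , refl , k<BK)))))

            BK∈ : ∀ (G : Edge ℋ) → k ∈ proj₁ G → orient B K ∈ proj₁ G
            BK∈ G = subst (_∈ proj₁ G) (sym BK≡k)

            -- Otherwise `k` lies in `H₀` between `i` and `j`, and `H₀` and `K` form a two-cycle of
            -- `B`.
            k≮j : ¬ k Fin.< j
            k≮j k<j = Fin.<⇒≢ k<j (trans (sym BK≡k) (trans
              (sym (pairwise B H₀ K (subst (_∈ proj₁ K) (sym BH₀≡j) j∈K)
                     (BK∈ H₀ (convex H₀ (i∈ H₀ AH₀≡i) j∈H₀ (ℕ.<⇒≤ i<k) (ℕ.<⇒≤ k<j)))))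
              BH₀≡j))

            -- Otherwise some target beyond k contradicts the maximality of j.
            j≮k : ¬ j Fin.< k
            j≮k j<k = beyond (target {Q = λ G → k ∈ proj₁ G} (λ G → k ∈? proj₁ G)
              (λ G AG≡i k∈G → ℕ.<-≤-trans i<j (j≤B G AG≡i k∈G))
              (λ G L AG≡i k∈G AL≡i BG∈L →
                 convex L (i∈ L AL≡i) BG∈L (ℕ.<⇒≤ i<k) (k≤B G AG≡i k∈G))
              H AH≡i AK∈H)
              where
              j≤B : ∀ G → orient A G ≡ i → k ∈ proj₁ G → j Fin.≤ orient B G
              j≤B G AG≡i k∈G = proj₂ target-j G AG≡i
                (convex G (i∈ G AG≡i) k∈G (ℕ.<⇒≤ i<j) (ℕ.<⇒≤ j<k))
              -- Otherwise `B G` lies in `K` between `j` and `k`, and `G` and `K` form a two-cycle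
              -- of `B`.
              k≤B : ∀ G → orient A G ≡ i → k ∈ proj₁ G → k Fin.≤ orient B G
              k≤B G AG≡i k∈G = ℕ.≮⇒≥ λ BG<k → Fin.<⇒≢ BG<k (trans
                (pairwise B G K (convex K j∈K k∈K (j≤B G AG≡i k∈G) (ℕ.<⇒≤ BG<k)) (BK∈ G k∈G))
                BK≡k)
              beyond : ¬ (∃ λ G → orient A G ≡ i × k ∈ proj₁ G × Target (orient B G))
              beyond (G , AG≡i , k∈G , t) =
                ℕ.<⇒≱ j<k (ℕ.≤-trans (k≤B G AG≡i k∈G) (j-max _ t))

          -- So nothing lies strictly between i and j in the order of A, which is
          -- what keeps the flip from i to j acyclic.
          cover : orient A K ≡ j
          cover with Fin.<-cmp k j
          ... | tri< k<j _ _ = contradiction k<j k≮j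
          ... | tri≈ _ k≡j _ = k≡j
          ... | tri> _ _ j<k = contradiction j<k j≮k

        private
          affected-unaffected : ∀ H K → Affected H → ¬ Affected K →
                                j ∈ proj₁ K → orient A K ∈ proj₁ H → orient A K ≡ j
          affected-unaffected H K (AH≡i , j∈H) ¬affK j∈K AK∈H =
            cover H K AH≡i j∈H j∈K AK∈H λ AK≡i → ¬affK (AK≡i , j∈K)

        flipped-pairwise : PairwiseAcyclic ℋ flipped
        flipped-pairwise H K fH∈K fK∈H with affected? H | affected? K
        ... | yes _    | yes _    = refl
        ... | yes affH | no ¬affK = sym (affected-unaffected H K affH ¬affK fH∈K fK∈H)
        ... | no ¬affH | yes affK = affected-unaffected K H affK ¬affH fK∈H fH∈K
        ... | no _     | no _     = pairwise A H K fH∈K fK∈H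

        flippedOrientation : AcyclicOrientation ℋ
        flippedOrientation = acyclicOrientation flipped∈ flipped-pairwise

        flipped-H₀ : flipped H₀ ≡ j
        flipped-H₀ with affected? H₀
        ... | yes _    = refl
        ... | no  ¬aff = contradiction (AH₀≡i , j∈H₀) ¬aff

        increases-at-H₀ : orient A H₀ Fin.< flipped H₀
        increases-at-H₀ = subst₂ Fin._<_ (sym AH₀≡i) (sym flipped-H₀) i<j

        flipped⊑B : flippedOrientation ⊑ B
        flipped⊑B H with affected? H
        ... | yes (AH≡i , j∈H) = proj₂ target-j H AH≡i j∈H
        ... | no  _            = A⊑B H

        increasingFlip : IncreasingFlip ℋ A flippedOrientation
        increasingFlip = (λ A≈ → Fin.<⇒≢ increases-at-H₀ (A≈ H₀)) , i , j , i<j ,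
                         λ H → changes H , swap H
          where
          changes : ∀ H → orient A H ≢ flipped H → orient A H ≡ i × flipped H ≡ j
          changes H A≢ with affected? H
          ... | yes (AH≡i , _) = AH≡i , refl
          ... | no  _          = contradiction refl A≢
          swap : ∀ H → i ∈ proj₁ H → j ∈ proj₁ H → orient A H ≡ i ⇔ flipped H ≡ j
          swap H i∈H j∈H with affected? H
          ... | yes (AH≡i , _) = mk⇔ (λ _ → refl) (λ _ → AH≡i)
          -- Here `flipped H` is `A H`. Were it `j`, then `j ∈ H₀` and `i ∈ H` would make `A` agree
          -- on `H` and `H₀`.
          ... | no  ¬aff       = mk⇔ (λ AH≡i → contradiction (AH≡i , j∈H) ¬aff) λ AH≡j →
            trans (pairwise A H H₀ (subst (_∈ proj₁ H₀) (sym AH≡j) j∈H₀)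
                                   (subst (_∈ proj₁ H) (sym AH₀≡i) i∈H))
                  AH₀≡i

    flipTowards : ∃ Raised → ∃ λ C → IncreasingFlip ℋ A C × C ⊑ B ×
                                     (∃ λ H → orient A H Fin.< orient C H)
    flipTowards raised =
      let (i , raised-i , i-max) = least Fin-≥-isDecTotalOrder raised? raised
          (j , target-j , j-max) = least Fin-≥-isDecTotalOrder (At.target? i i-max)
                                     (At.initialTarget i i-max raised-i)
          open At.FlipTo i i-max j target-j j-max
      in flippedOrientation , increasingFlip , flipped⊑B , _ , increases-at-H₀

  -- Non-edges contribute 0, so the termination measure `distance` can range over all subsets.
  gap : (A B : AcyclicOrientation ℋ) → Subset n → ℕ
  gap A B H with T? (ℋ H)
  ... | yes h = toℕ (orient B (H , h)) ∸ toℕ (orient A (H , h))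
  ... | no  _ = 0

  distance : (A B : AcyclicOrientation ℋ) → ℕ
  distance A B = sumSubsets (gap A B)

  distance-decreases : ∀ {A B C} → A ⊑ C → C ⊑ B → (∃ λ H → orient A H Fin.< orient C H) →
                       distance C B ℕ.< distance A B
  distance-decreases {A} {B} {C} A⊑C C⊑B ((H , h) , A<C) = sumSubsets-mono-< gap-≤ H gap-<
    where
    gap-≤ : ∀ K → gap C B K ≤ gap A B K
    gap-≤ K with T? (ℋ K)
    ... | yes k = ℕ.∸-monoʳ-≤ (toℕ (orient B (K , k))) (A⊑C (K , k))
    ... | no  _ = ℕ.z≤n
    gap-< : gap C B H ℕ.< gap A B H
    gap-< with T? (ℋ H)
    ... | no ¬h = contradiction h ¬h
    ... | yes h′ rewrite T-irrelevant h′ h = ℕ.∸-monoʳ-< A<C (C⊑B (H , h))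

  -- Orientations are compared by `≈ₒ`; a chain ending in a pointwise equality absorbs it into its
  -- last flip.
  flip-respʳ : ∀ {A B C} → IncreasingFlip ℋ A C → _≈ₒ_ ℋ C B → IncreasingFlip ℋ A B
  flip-respʳ {A} {B} {C} (A≉C , i , j , i<j , flips) C≈B =
    (λ A≈B → A≉C λ H → trans (A≈B H) (sym (C≈B H))) , i , j , i<j ,
    λ H → subst (λ x → (orient A H ≢ x → orient A H ≡ i × x ≡ j) ×
                       (i ∈ proj₁ H → j ∈ proj₁ H → orient A H ≡ i ⇔ x ≡ j))
                (C≈B H) (flips H)

  flip-≤ₒ : ∀ {A B C} → IncreasingFlip ℋ A C → _≤ₒ_ ℋ C B → _<ₒ_ ℋ A B
  flip-≤ₒ s (inj₁ C<B) = s ∷ C<B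
  flip-≤ₒ {A} {B} {C} s (inj₂ C≈B) = [ flip-respʳ {A} {B} {C} s C≈B ]

  -- Each flip given by `flipTowards` stays below `B` and shrinks `distance`, so repetition ends in
  -- pointwise equality with `B`.
  ⊑⇒≤ₒ : ∀ {A B} → A ⊑ B → _≤ₒ_ ℋ A B
  ⊑⇒≤ₒ {A} {B} A⊑B = go A A⊑B (<-wellFounded (distance A B))
    where
    go : ∀ A → A ⊑ B → Acc ℕ._<_ (distance A B) → _≤ₒ_ ℋ A B
    go A A⊑B (acc rec) with anyEdge? ℋ (λ H → orient A H Fin.<? orient B H)
    ... | no ¬< = inj₂ λ H →
      Fin.toℕ-injective (ℕ.≤-antisym (A⊑B H) (ℕ.≮⇒≥ λ A<B → ¬< (H , A<B)))
    ... | yes (H , A<B) =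
      let (C , s , C⊑B , A<C) = FlipTowards.flipTowards {A} {B} A⊑B (_ , H , refl , A<B)
      in inj₁ (flip-≤ₒ {A} {B} {C} s (go C C⊑B (rec
           (distance-decreases {A} {B} {C} (flip⇒⊑ {A} {C} s) C⊑B A<C))))

  ≤ₒ-isPartialOrder : IsPartialOrder (_≈ₒ_ ℋ) (_≤ₒ_ ℋ)
  ≤ₒ-isPartialOrder = record
    { isPreorder = record
      { isEquivalence = record
        { refl  = λ _ → refl
        ; sym   = λ A≈B H → sym (A≈B H)
        ; trans = λ A≈B B≈C H → trans (A≈B H) (B≈C H)
        }
      ; reflexive = inj₂
      ; trans     = λ {A} {B} {C} A≤B B≤C → ⊑⇒≤ₒ {A} {C} λ H →
          ℕ.≤-trans (≤ₒ⇒⊑ {A} {B} A≤B H) (≤ₒ⇒⊑ {B} {C} B≤C H)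
      }
    ; antisym = λ {A} {B} A≤B B≤A H → Fin.toℕ-injective
        (ℕ.≤-antisym (≤ₒ⇒⊑ {A} {B} A≤B H) (≤ₒ⇒⊑ {B} {A} B≤A H))
    }

  -- From closure under intersection to the lattice.

  closed⇒lattice : ClosedUnderIntersection ℋ → HypergraphicPosetIsLattice ℋ
  closed⇒lattice closed = _∨_ , _∧_ , record
    { isPartialOrder = ≤ₒ-isPartialOrder
    ; supremum = λ A B → let open Up.Join closed A B in
        ⊑⇒≤ₒ {A} {A ∨ B} A≼join , ⊑⇒≤ₒ {B} {A ∨ B} B≼join ,
        λ D A≤D B≤D → ⊑⇒≤ₒ {A ∨ B} {D} (join≼ D (≤ₒ⇒⊑ {A} {D} A≤D) (≤ₒ⇒⊑ {B} {D} B≤D))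
    -- The meet is the join for `≥`, so here `A≼join` puts `A ∧ B` below `A`.
    ; infimum = λ A B → let open Down.Join closed A B in
        ⊑⇒≤ₒ {A ∧ B} {A} A≼join , ⊑⇒≤ₒ {A ∧ B} {B} B≼join ,
        λ D D≤A D≤B → ⊑⇒≤ₒ {D} {A ∧ B} (join≼ D (≤ₒ⇒⊑ {D} {A} D≤A) (≤ₒ⇒⊑ {D} {B} D≤B))
    }
    where
    _∨_ _∧_ : AcyclicOrientation ℋ → AcyclicOrientation ℋ → AcyclicOrientation ℋ
    A ∨ B = acyclicOrientation join∈ join-pairwiseAcyclic
      where open Up.Join closed A B
    A ∧ B = acyclicOrientation join∈ join-pairwiseAcyclic
      where open Down.Join closed A B

  -- From the lattice to closure under intersection.

  jumpUp : (s p : Fin n) → AcyclicOrientation ℋ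
  jumpUp s p = acyclicOrientation jump∈ jump-pairwiseAcyclic
    where open Up.Jump s p

  -- For `≥`, `left` is the right end: an edge containing `p` and ending at or before `s` takes `p`,
  -- any other its last element.
  jumpDown : (s p : Fin n) → AcyclicOrientation ℋ
  jumpDown s p = acyclicOrientation jump∈ jump-pairwiseAcyclic
    where open Down.Jump s p

  -- An edge that fails to jump in one of the two takes an extreme element there, so only edges
  -- jumping in both need a comparison.
  jumpUp⊑jumpDown : ∀ s p t q →
    (∀ H → p ∈ proj₁ H → q ∈ proj₁ H → s Fin.≤ Up.left H → Up.right H Fin.≤ t → p Fin.≤ q) →
    jumpUp s p ⊑ jumpDown t q
  jumpUp⊑jumpDown s p t q p≤q H with Up.Jump.jump-cases s p H | Down.Jump.jump-cases t q H
  ... | inj₁ ≡left | _ = subst (Fin._≤ orient (jumpDown t q) H) (sym ≡left)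
    (Up.left≼ H (isOrientation (jumpDown t q) H))
  ... | inj₂ _ | inj₁ ≡right = subst (orient (jumpUp s p) H Fin.≤_) (sym ≡right)
    (Up.≼right H (isOrientation (jumpUp s p) H))
  ... | inj₂ (≡p , p∈H , s≤) | inj₂ (≡q , q∈H , ≤t) =
    subst₂ Fin._≤_ (sym ≡p) (sym ≡q) (p≤q H p∈H q∈H s≤ ≤t)

  -- With I = [a,b] and J = [c,d] such that [c,b] is not an edge, the join of
  -- jumpUp c b and jumpUp a c lies below jumpDown b c and jumpDown d b, hence
  -- selects c in I and b in J.
  crossing : (∀ i → ⁅ i ⁆ ∈ₕ ℋ) → HypergraphicPosetIsLattice ℋ → (I J : Edge ℋ) →
             Up.left I Fin.≤ Up.left J → Up.left J Fin.≤ Up.right I → Up.right I Fin.≤ Up.right J →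
             (proj₁ I ∩ proj₁ J) ∈ₕ ℋ
  crossing singletons (_∨_ , _ , isLattice) I J a≤c c≤b b≤d =
    decidable-stable (T? _) λ I∩J∉ℋ →
      let c≢b : c ≢ b
          -- If `c = b`, the intersection is the singleton `⁅ c ⁆`, an edge by hypothesis.
          c≢b c≡b = I∩J∉ℋ (subst (_∈ₕ ℋ)
            (onlyEdge (⁅ c ⁆ , singletons c) (x∈⁅x⁆ c) (subst (_∈ ⁅ c ⁆) c≡b (x∈⁅x⁆ c))
              (ℕ.≤-reflexive (cong toℕ (sym (x∈⁅y⁆⇒x≡y c (Up.left∈ (⁅ c ⁆ , singletons c))))))
              (ℕ.≤-reflexive (cong toℕ (trans (x∈⁅y⁆⇒x≡y c (Up.right∈ (⁅ c ⁆ , singletons c))) c≡b))))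
            (singletons c))
          A≤C : A ≼ C
          -- An edge jumping in both `A` and `C` would be [c,b], which is not an edge.
          A≤C = ⊑⇒≤ₒ {A} {C} (jumpUp⊑jumpDown c b b c λ H b∈H c∈H c≤ ≤b →
            contradiction (subst (_∈ₕ ℋ) (onlyEdge H c∈H b∈H c≤ ≤b) (proj₂ H)) I∩J∉ℋ)
          E≤C = ∨-least {A} {B} {C} A≤C B≤C
          E≤D = ∨-least {A} {B} {D} A≤D B≤D
          -- `B` and `C` both take the value `c` at `I`; likewise `A` and `D` both take `b` at `J`.
          EI≡c : orient E I ≡ c
          EI≡c = between
            (subst (Fin._≤ orient E I) (Up.Jump.jump-p a c I (c∈I , ℕ.≤-refl))
              (≤ₒ⇒⊑ {B} {E} (y≤x∨y A B) I))
            (subst (orient E I Fin.≤_) (Down.Jump.jump-p b c I (c∈I , ℕ.≤-refl))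
              (≤ₒ⇒⊑ {E} {C} E≤C I))
          EJ≡b : orient E J ≡ b
          EJ≡b = between
            (subst (Fin._≤ orient E J) (Up.Jump.jump-p c b J (b∈J , ℕ.≤-refl))
              (≤ₒ⇒⊑ {A} {E} (x≤x∨y A B) J))
            (subst (orient E J Fin.≤_) (Down.Jump.jump-p d b J (b∈J , ℕ.≤-refl))
              (≤ₒ⇒⊑ {E} {D} E≤D J))
      in c≢b (trans (sym EI≡c) (trans
           (pairwise E I J (subst (_∈ proj₁ J) (sym EI≡c) (Up.left∈ J))
                           (subst (_∈ proj₁ I) (sym EJ≡b) (Up.right∈ I)))
           EJ≡b))
    where
    open IsLattice isLattice using (x≤x∨y; y≤x∨y; ∨-least)
    a b c d : Fin n
    a = Up.left I
    b = Up.right I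
    c = Up.left J
    d = Up.right J
    infix 4 _≼_
    _≼_ : Rel (AcyclicOrientation ℋ) 0ℓ
    _≼_ = _≤ₒ_ ℋ
    between : ∀ {x y : Fin n} → y Fin.≤ x → x Fin.≤ y → x ≡ y
    between y≤x x≤y = Fin.toℕ-injective (ℕ.≤-antisym x≤y y≤x)
    A B C D E : AcyclicOrientation ℋ
    A = jumpUp c b
    B = jumpUp a c
    C = jumpDown b c
    D = jumpDown d b
    E = A ∨ B
    A≤D : A ≼ D
    A≤D = ⊑⇒≤ₒ {A} {D} (jumpUp⊑jumpDown c b d b λ _ _ _ _ _ → ℕ.≤-refl)
    B≤C : B ≼ C
    B≤C = ⊑⇒≤ₒ {B} {C} (jumpUp⊑jumpDown a c b c λ _ _ _ _ _ → ℕ.≤-refl)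
    B≤D : B ≼ D
    B≤D = ⊑⇒≤ₒ {B} {D} (jumpUp⊑jumpDown a c d b λ _ _ _ _ _ → c≤b)
    c∈I : c ∈ proj₁ I
    c∈I = Up.between∈ I c a≤c c≤b
    b∈J : b ∈ proj₁ J
    b∈J = Up.between∈ J b c≤b b≤d
    onlyEdge : ∀ H → c ∈ proj₁ H → b ∈ proj₁ H → c Fin.≤ Up.left H → Up.right H Fin.≤ b →
               proj₁ H ≡ proj₁ I ∩ proj₁ J
    onlyEdge H c∈H b∈H c≤ ≤b = ⊆-antisym
      (λ x∈H → let c≤x = ℕ.≤-trans c≤ (Up.left≼ H x∈H)
                   x≤b = ℕ.≤-trans (Up.≼right H x∈H) ≤b
               in x∈p∩q⁺ (Up.between∈ I _ (ℕ.≤-trans a≤c c≤x) x≤b ,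
                          Up.between∈ J _ c≤x (ℕ.≤-trans x≤b b≤d)))
      (λ x∈I∩J → let (x∈I , x∈J) = x∈p∩q⁻ _ _ x∈I∩J
                 in convex H c∈H b∈H (Up.left≼ J x∈J) (Up.≼right I x∈I))

  nested : (I J : Edge ℋ) → Up.left J Fin.≤ Up.left I → Up.right I Fin.≤ Up.right J →
           (proj₁ I ∩ proj₁ J) ∈ₕ ℋ
  nested I J l r = subst (_∈ₕ ℋ) (⊆-antisym
    (λ x∈I → x∈p∩q⁺ (x∈I , Up.between∈ J _ (ℕ.≤-trans l (Up.left≼ I x∈I))
                                           (ℕ.≤-trans (Up.≼right I x∈I) r)))
    (p∩q⊆p _ _)) (proj₂ I)

  -- Comparing end points leaves two nested cases, where the intersection is the smaller edge, and
  -- two crossing cases, exchanged by swapping `I` and `J`.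
  lattice⇒closed : (∀ i → ⁅ i ⁆ ∈ₕ ℋ) → HypergraphicPosetIsLattice ℋ → ClosedUnderIntersection ℋ
  lattice⇒closed singletons lattice I J I∈ J∈ (x , x∈I∩J)
    with ℕ.≤-total (toℕ (Up.left (I , I∈))) (toℕ (Up.left (J , J∈)))
       | ℕ.≤-total (toℕ (Up.right (I , I∈))) (toℕ (Up.right (J , J∈)))
       | x∈p∩q⁻ I J x∈I∩J
  ... | inj₁ a≤c | inj₁ b≤d | x∈I , x∈J = crossing singletons lattice (I , I∈) (J , J∈) a≤c
    (ℕ.≤-trans (Up.left≼ (J , J∈) x∈J) (Up.≼right (I , I∈) x∈I)) b≤d
  ... | inj₂ c≤a | inj₁ b≤d | _ = nested (I , I∈) (J , J∈) c≤a b≤d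
  ... | inj₁ a≤c | inj₂ d≤b | _ = subst (_∈ₕ ℋ) (∩-comm J I)
    (nested (J , J∈) (I , I∈) a≤c d≤b)
  ... | inj₂ c≤a | inj₂ d≤b | x∈I , x∈J = subst (_∈ₕ ℋ) (∩-comm J I)
    (crossing singletons lattice (J , J∈) (I , I∈) c≤a
      (ℕ.≤-trans (Up.left≼ (I , I∈) x∈I) (Up.≼right (J , J∈) x∈J)) d≤b)

theoremA : (n : ℕ) → 1 ≤ n → (ℐ : Hypergraph n) →
    IsIntervalHypergraph ℐ → ((i : Fin n) → ⁅ i ⁆ ∈ₕ ℐ) →
    HypergraphicPosetIsLattice ℐ ⇔ ClosedUnderIntersection ℐ
theoremA n _ ℐ isInterval singletons = mk⇔ (lattice⇒closed singletons) closed⇒lattice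
  where open IntervalHypergraph ℐ isInterval
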